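{- Let $\langle A,\to\rangle$ be a conditional algebra and $Y$ a closed subset of the Stone space $\mathrm{Ul}(A)$. Then $\theta(Y)=\{(a,b)\in A^2: Y\cap\varphi(a)=Y\cap\varphi(b)\}$ is a congruence of $\langle A,\to\rangle$ if and only if $Y$ is a $T_A$-closed set.
   Context: A conditional algebra is $\langle A,\to\rangle$ with $A$ a Boolean algebra and $\to$ binary with $a\to1=1$, $(a\to b)\wedge(a\to c)=a\to(b\wedge c)$, $(a\vee b)\to c\le(a\to c)\wedge(b\to c)$. $\mathrm{Ul}(A)$ is the Stone space of ultrafilters, $\varphi(a)=\{u:a\in u\}$; closed sets are $\varphi(F)=\{u:F\subseteq u\}$ for filters $F$ (including $F=A$). $D^{\to}_u(F)=\{b:\exists a\in F,\ a\to b\in u\}$; $T_A(u,Z,v)$ iff there is a filter $F$ with $Z=\varphi(F)$ and $D^{\to}_u(F)\subseteq v$. For $x,y\in\mathrm{Ul}(A)$, $\mathbf{C}(x,y)$ is the set of closed $Z$ with $T_A(x,Z,y)$. A closed set $Y$ is $T_A$-closed if for all $x,y$: if $x\in Y$ and $Z$ is a minimal element (w.r.t. inclusion) of $\mathbf{C}(x,y)$, then $Z\subseteq Y$ and $y\in Y$. -}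

module Defs where

open import Level using (Level; _⊔_; suc)
open import Algebra.Core using (Op₂)
open import Algebra.Definitions using (Congruent₁; Congruent₂)
open import Algebra.Lattice.Bundles using (BooleanAlgebra)
import Algebra.Lattice.Properties.Lattice as LatticeProperties
open import Data.Product.Base using (∃; ∃-syntax; _×_)
open import Data.Sum.Base using (_⊎_)
open import Relation.Binary.Bundles using (Poset)
open import Relation.Binary.Core using (Rel)
open import Relation.Binary.Structures using (IsEquivalence)
open import Relation.Nullary.Negation using () renaming (¬_ to Not_)
open import Relation.Unary using (Pred; _∈_; _⊆_; _∩_; _≐_)

-- Stone duality is carried out in ZFC.  Zorn's lemma is stated here, for an
-- arbitrary poset, so that it can be taken as an explicit hypothesis.  The
-- empty chain is a chain, so the premise forces the poset to be inhabited.

module _ {o ℓ₁ ℓ₂ : Level} (P : Poset o ℓ₁ ℓ₂) where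
  open Poset P

  IsChain : ∀ {q} → Pred Carrier q → Set (o ⊔ ℓ₂ ⊔ q)
  IsChain K = ∀ {x y} → x ∈ K → y ∈ K → x ≤ y ⊎ y ≤ x

  IsUpperBound : ∀ {q} → Pred Carrier q → Carrier → Set (o ⊔ ℓ₂ ⊔ q)
  IsUpperBound K b = ∀ {x} → x ∈ K → x ≤ b

  IsMaximal : Carrier → Set (o ⊔ ℓ₁ ⊔ ℓ₂)
  IsMaximal m = ∀ {x} → m ≤ x → m ≈ x

ZornsLemma : ∀ o ℓ₁ ℓ₂ q → Set (suc (o ⊔ ℓ₁ ⊔ ℓ₂ ⊔ q))
ZornsLemma o ℓ₁ ℓ₂ q =
  (P : Poset o ℓ₁ ℓ₂) →
  ((K : Pred (Poset.Carrier P) q) → IsChain P K → ∃ (IsUpperBound P K)) →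
  ∃ (IsMaximal P)

record ConditionalAlgebra c ℓ : Set (suc (c ⊔ ℓ)) where
  infixr 5 _⇒_
  field
    booleanAlgebra : BooleanAlgebra c ℓ

  open BooleanAlgebra booleanAlgebra public
  open Poset (LatticeProperties.poset lattice) public using (_≤_)

  field
    _⇒_     : Op₂ Carrier
    ⇒-cong  : Congruent₂ _≈_ _⇒_
    ⇒-⊤     : ∀ a → a ⇒ ⊤ ≈ ⊤
    ⇒-∧     : ∀ a b c → (a ⇒ b) ∧ (a ⇒ c) ≈ a ⇒ (b ∧ c)
    ∨-⇒     : ∀ a b c → (a ∨ b) ⇒ c ≤ (a ⇒ c) ∧ (b ⇒ c)

module _ {c ℓ : Level} (A : ConditionalAlgebra c ℓ) where
  open ConditionalAlgebra A

  -- Subsets of the algebra, and subsets of its Stone space, are predicates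
  -- valued in Set (c ⊔ ℓ), and equality of subsets is extensional (_≐_).

  record IsFilter (F : Pred Carrier (c ⊔ ℓ)) : Set (c ⊔ ℓ) where
    field
      ⊤-mem    : ⊤ ∈ F
      ∧-closed : ∀ {a b} → a ∈ F → b ∈ F → a ∧ b ∈ F
      ≤-closed : ∀ {a b} → a ≤ b → a ∈ F → b ∈ F

  record IsProperFilter (F : Pred Carrier (c ⊔ ℓ)) : Set (c ⊔ ℓ) where
    field
      isFilter : IsFilter F
      proper   : Not (⊥ ∈ F)

  record IsUltrafilter (U : Pred Carrier (c ⊔ ℓ)) : Set (suc (c ⊔ ℓ)) where
    field
      isProperFilter : IsProperFilter U
      maximal        : ∀ G → IsProperFilter G → U ⊆ G → G ⊆ U

  record Ul : Set (suc (c ⊔ ℓ)) where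
    field
      set           : Pred Carrier (c ⊔ ℓ)
      isUltrafilter : IsUltrafilter set

  open Ul using (set)

  φ : Carrier → Pred Ul (c ⊔ ℓ)
  φ a u = a ∈ set u

  φ[_] : Pred Carrier (c ⊔ ℓ) → Pred Ul (c ⊔ ℓ)
  φ[ F ] u = F ⊆ set u

  IsClosed : Pred Ul (c ⊔ ℓ) → Set (suc (c ⊔ ℓ))
  IsClosed Z = ∃[ F ] IsFilter F × Z ≐ φ[ F ]

  D : Ul → Pred Carrier (c ⊔ ℓ) → Pred Carrier (c ⊔ ℓ)
  D u F b = ∃[ a ] a ∈ F × (a ⇒ b) ∈ set u

  T : Ul → Pred Ul (c ⊔ ℓ) → Ul → Set (suc (c ⊔ ℓ))
  T u Z v = ∃[ F ] IsFilter F × Z ≐ φ[ F ] × D u F ⊆ set v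

  𝐂 : Ul → Ul → Pred (Pred Ul (c ⊔ ℓ)) (suc (c ⊔ ℓ))
  𝐂 x y Z = IsClosed Z × T x Z y

  IsMinimalIn : Pred (Pred Ul (c ⊔ ℓ)) (suc (c ⊔ ℓ)) →
                Pred Ul (c ⊔ ℓ) → Set (suc (c ⊔ ℓ))
  IsMinimalIn 𝒮 Z = Z ∈ 𝒮 × (∀ Z′ → Z′ ∈ 𝒮 → Z′ ⊆ Z → Z′ ≐ Z)

  record IsTClosed (Y : Pred Ul (c ⊔ ℓ)) : Set (suc (c ⊔ ℓ)) where
    field
      isClosed : IsClosed Y
      closure  : ∀ x y Z → x ∈ Y → IsMinimalIn (𝐂 x y) Z → Z ⊆ Y × y ∈ Y

  -- A congruence on the setoid-based algebra must contain the underlying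
  -- equality _≈_; compatibility with the constants ⊤ and ⊥ is reflexivity.

  record IsCongruence {r} (R : Rel Carrier r) : Set (c ⊔ ℓ ⊔ r) where
    field
      isEquivalence : IsEquivalence R
      ≈-included    : ∀ {a b} → a ≈ b → R a b
      ∧-compatible  : Congruent₂ R _∧_
      ∨-compatible  : Congruent₂ R _∨_
      ¬-compatible  : Congruent₁ R ¬_
      ⇒-compatible  : Congruent₂ R _⇒_

  θ : Pred Ul (c ⊔ ℓ) → Rel Carrier (suc (c ⊔ ℓ))
  θ Y a b = (Y ∩ φ a) ≐ (Y ∩ φ b)

{-# OPTIONS --safe #-}

-- Closed sets Z = φ[ F ] correspond to filters F with inclusion reversed, so a
-- minimal element of 𝐂 x y is a maximal filter F with D x F ⊆ y.  Write
-- Y = φ[ G ].  If θ Y is a congruence and x ∈ Y, then f ∧ g and f are θ-related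
-- for g ∈ G, so joining G to F does not enlarge D x F; maximality gives G ⊆ F.
-- Conversely, let a ⇒ b ∈ x ∈ Y with a, a′ and b, b′ θ-related.  To get
-- a′ ⇒ b′ ∈ x it suffices that b′ lies in every ultrafilter y containing the
-- filter { d : a′ ⇒ d ∈ x }.  Extend ↑ a′ to a maximal F with D x F ⊆ y.  By
-- T-closedness φ[ F ] ⊆ Y and y ∈ Y, so a′ ∈ F gives a ∈ F, hence b ∈ y, hence
-- b′ ∈ y.

module Submission where

open import Defs
open import Level using (Level; _⊔_; suc; Lift; lift; lower)
open import Axiom.ExcludedMiddle using (ExcludedMiddle)
open import Algebra.Core using (Op₂)
open import Algebra.Definitions using (Congruent₁; Congruent₂)
import Algebra.Lattice.Properties.BooleanAlgebra as BooleanAlgebraProperties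
import Algebra.Lattice.Properties.Lattice as LatticeProperties
open import Data.Product.Base using (∃; ∃-syntax; _×_; _,_; proj₁; proj₂)
open import Data.Sum.Base using (inj₁; inj₂)
open import Function.Base using (id; _∘_)
open import Function.Bundles using (_⇔_; mk⇔)
open import Relation.Binary.Bundles using (Poset)
open import Relation.Binary.Lattice using (Lattice)
open import Relation.Nullary.Decidable using (Dec; yes; no; True; toWitness; fromWitness; map′)
open import Relation.Nullary.Negation using (contradiction) renaming (¬_ to Not_)
open import Relation.Unary using (Pred; _∈_; _⊆_; _≐_)
import Relation.Binary.Reasoning.PartialOrder as ≤-Reasoning

-- Order, filters and ultrafilters of a conditional algebra.

module FilterProperties {c ℓ : Level} (A : ConditionalAlgebra c ℓ) where
  open ConditionalAlgebra A hiding (_≤_)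
  open BooleanAlgebraProperties booleanAlgebra using (∧-zeroˡ; ∧-identityʳ)
  open LatticeProperties lattice using (∨-∧-orderTheoreticLattice; poset)
  open Lattice ∨-∧-orderTheoreticLattice
    using (_≤_; x∧y≤x; x∧y≤y; ∧-greatest; y≤x∨y; ∨-least)
    renaming (refl to ≤-refl; trans to ≤-trans; reflexive to ≤-reflexive; antisym to ≤-antisym)
  open ≤-Reasoning poset

  Subset : Set (suc (c ⊔ ℓ))
  Subset = Pred Carrier (c ⊔ ℓ)

  ∧-mono-≤ : ∀ {a b a′ b′} → a ≤ a′ → b ≤ b′ → a ∧ b ≤ a′ ∧ b′
  ∧-mono-≤ p q = ∧-greatest (≤-trans (x∧y≤x _ _) p) (≤-trans (x∧y≤y _ _) q)

  x≤⊤ : ∀ x → x ≤ ⊤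
  x≤⊤ x = sym (∧-identityʳ x)

  ⊥≤x : ∀ x → ⊥ ≤ x
  ⊥≤x x = sym (∧-zeroˡ x)

  x∧¬y≤⊥⇒x≤y : ∀ {x y} → x ∧ ¬ y ≤ ⊥ → x ≤ y
  x∧¬y≤⊥⇒x≤y {x} {y} p = begin
    x                   ≈⟨ ∧-identityʳ x ⟨
    x ∧ ⊤               ≈⟨ ∧-congˡ (∨-complementʳ y) ⟨
    x ∧ (y ∨ ¬ y)       ≈⟨ ∧-distribˡ-∨ x y (¬ y) ⟩
    (x ∧ y) ∨ (x ∧ ¬ y) ≤⟨ ∨-least (x∧y≤y x y) (≤-trans p (⊥≤x y)) ⟩
    y                   ∎

  -- When `a ≤ b`, the element `b` equals `a ∨ b`, so the join axiom bounds `b ⇒ c` by `a ⇒ c`.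
  ⇒-antitoneˡ : ∀ {a b} c → a ≤ b → b ⇒ c ≤ a ⇒ c
  ⇒-antitoneˡ {a} {b} c a≤b = begin
    b ⇒ c             ≈⟨ ⇒-cong b≈a∨b refl ⟩
    (a ∨ b) ⇒ c       ≤⟨ ∨-⇒ a b c ⟩
    (a ⇒ c) ∧ (b ⇒ c) ≤⟨ x∧y≤x _ _ ⟩
    a ⇒ c             ∎
    where
    b≈a∨b : b ≈ a ∨ b
    b≈a∨b = ≤-antisym (y≤x∨y a b) (∨-least a≤b ≤-refl)

  ⇒-monoʳ : ∀ a {b c} → b ≤ c → a ⇒ b ≤ a ⇒ c
  ⇒-monoʳ a {b} {c} b≤c = begin
    a ⇒ b             ≈⟨ ⇒-cong refl b≤c ⟩
    a ⇒ (b ∧ c)       ≈⟨ ⇒-∧ a b c ⟨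
    (a ⇒ b) ∧ (a ⇒ c) ≤⟨ x∧y≤y _ _ ⟩
    a ⇒ c             ∎

  -- The order lives at level `ℓ` and subsets at level `c ⊔ ℓ`, hence the `Lift`.
  ↑ : Carrier → Subset
  ↑ a b = Lift c (a ≤ b)

  ↑-isFilter : ∀ a → IsFilter A (↑ a)
  ↑-isFilter a = record
    { ⊤-mem    = lift (x≤⊤ a)
    ; ∧-closed = λ (lift p) (lift q) → lift (∧-greatest p q)
    ; ≤-closed = λ p (lift q) → lift (≤-trans q p)
    }

  infixl 6 _⊕_

  -- For filters `F` and `G` this is their join, the filter generated by the union.
  _⊕_ : Subset → Subset → Subset
  (F ⊕ G) d = ∃[ f ] ∃[ g ] f ∈ F × g ∈ G × f ∧ g ≤ d

  module _ {F G : Subset} (F-filter : IsFilter A F) (G-filter : IsFilter A G) where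
    private
      module F = IsFilter F-filter
      module G = IsFilter G-filter

    ⊕-isFilter : IsFilter A (F ⊕ G)
    ⊕-isFilter = record
      { ⊤-mem    = ⊤ , ⊤ , F.⊤-mem , G.⊤-mem , x≤⊤ _
      ; ∧-closed = λ (f , g , f∈F , g∈G , p) (f′ , g′ , f′∈F , g′∈G , q) →
          f ∧ f′ , g ∧ g′ , F.∧-closed f∈F f′∈F , G.∧-closed g∈G g′∈G ,
          ∧-greatest (≤-trans (∧-mono-≤ (x∧y≤x _ _) (x∧y≤x _ _)) p)
                     (≤-trans (∧-mono-≤ (x∧y≤y _ _) (x∧y≤y _ _)) q)
      ; ≤-closed = λ p (f , g , f∈F , g∈G , q) → f , g , f∈F , g∈G , ≤-trans q p
      }

    ⊆-⊕ˡ : F ⊆ F ⊕ G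
    ⊆-⊕ˡ {f} f∈F = f , ⊤ , f∈F , G.⊤-mem , x∧y≤x _ _

    ⊆-⊕ʳ : G ⊆ F ⊕ G
    ⊆-⊕ʳ {g} g∈G = ⊤ , g , F.⊤-mem , g∈G , x∧y≤y _ _

  -- An inequality `f ∧ ¬ a ≤ ⊥` with `f ∈ F` would give `f ≤ a` and so put `a` into `F`.
  ⊕-↑¬-proper : ∀ {F a} → IsFilter A F → Not (a ∈ F) → IsProperFilter A (F ⊕ ↑ (¬ a))
  ⊕-↑¬-proper {F} {a} F-filter a∉F = record
    { isFilter = ⊕-isFilter F-filter (↑-isFilter (¬ a))
    ; proper   = λ (f , g , f∈F , lift ¬a≤g , p) →
        a∉F (IsFilter.≤-closed F-filter
              (x∧¬y≤⊥⇒x≤y (≤-trans (∧-mono-≤ ≤-refl ¬a≤g) p)) f∈F)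
    }

  ¬a∈⊕-↑¬ : ∀ {F a} → IsFilter A F → ¬ a ∈ F ⊕ ↑ (¬ a)
  ¬a∈⊕-↑¬ {a = a} F-filter = ⊆-⊕ʳ F-filter (↑-isFilter (¬ a)) (lift ≤-refl)

  module UltrafilterProperties (u : Ul A) where
    open Ul u public using (set)
    open IsUltrafilter (Ul.isUltrafilter u) public using (isProperFilter; maximal)
    open IsProperFilter isProperFilter public using (isFilter; proper)
    open IsFilter isFilter public

    ∧-projˡ : ∀ {a b} → a ∧ b ∈ set → a ∈ set
    ∧-projˡ = ≤-closed (x∧y≤x _ _)

    ∧-projʳ : ∀ {a b} → a ∧ b ∈ set → b ∈ set
    ∧-projʳ = ≤-closed (x∧y≤y _ _)

    ¬-∉ : ∀ {a} → ¬ a ∈ set → Not (a ∈ set)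
    ¬-∉ ¬a∈u a∈u = proper (≤-closed (≤-reflexive (∧-complementʳ _)) (∧-closed a∈u ¬a∈u))

    -- Adjoining `¬ a` yields a proper filter, so by maximality `¬ a` was already present.
    ∉-¬ : ∀ {a} → Not (a ∈ set) → ¬ a ∈ set
    ∉-¬ {a} a∉u = maximal (set ⊕ ↑ (¬ a)) (⊕-↑¬-proper isFilter a∉u)
      (⊆-⊕ˡ isFilter (↑-isFilter (¬ a))) (¬a∈⊕-↑¬ isFilter)

    conditional-isFilter : ∀ a → IsFilter A (λ b → (a ⇒ b) ∈ set)
    conditional-isFilter a = record
      { ⊤-mem    = ≤-closed (≤-reflexive (sym (⇒-⊤ a))) ⊤-mem
      ; ∧-closed = λ p q → ≤-closed (≤-reflexive (⇒-∧ a _ _)) (∧-closed p q)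
      ; ≤-closed = λ b≤c → ≤-closed (⇒-monoʳ a b≤c)
      }

-- Maximal filters by Zorn's lemma, ultrafilters and minimal closed sets.

module Classical {c ℓ : Level}
  (em : ExcludedMiddle (suc (c ⊔ ℓ)))
  (zorn : ZornsLemma (suc (c ⊔ ℓ)) (c ⊔ ℓ) (c ⊔ ℓ) (suc (c ⊔ ℓ)))
  (A : ConditionalAlgebra c ℓ) where

  open ConditionalAlgebra A hiding (_≤_)
  open FilterProperties A
  open LatticeProperties lattice using (∨-∧-orderTheoreticLattice)
  open Lattice ∨-∧-orderTheoreticLattice using (_≤_)
    renaming (refl to ≤-refl; reflexive to ≤-reflexive)
  open Ul using (set)

  em-small : (P : Set (c ⊔ ℓ)) → Dec P
  em-small P = map′ lower lift (em {Lift (suc (c ⊔ ℓ)) P})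

  -- Unions of chains live one universe too high; excluded middle brings a
  -- proposition down to any level.
  Resize : Set (suc (c ⊔ ℓ)) → Set (c ⊔ ℓ)
  Resize P = Lift (c ⊔ ℓ) (True (em {P}))

  resize : ∀ {P} → P → Resize P
  resize p = lift (fromWitness p)

  unresize : ∀ {P} → Resize P → P
  unresize (lift t) = toWitness t

  module _ (S : Subset) where

    -- One Zorn argument serves twice: `S` is the set of nonzero elements for ultrafilters, and the
    -- set of admissible antecedents for minimal members of `𝐂 x y`.
    record FilterWithin : Set (suc (c ⊔ ℓ)) where
      field
        filter   : Subset
        isFilter : IsFilter A filter
        within   : filter ⊆ S

    open FilterWithin

    IsMaximalWithin : FilterWithin → Set (suc (c ⊔ ℓ))
    IsMaximalWithin M = ∀ G → IsFilter A G → G ⊆ S → filter M ⊆ G → G ⊆ filter M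

    module _ (F : FilterWithin) where

      -- Zorn's lemma does not say where the maximal element lies, so only filters above `F` enter
      -- the poset.
      Extension : Set (suc (c ⊔ ℓ))
      Extension = ∃[ G ] filter F ⊆ filter G

      ⟦_⟧ : Extension → Subset
      ⟦ G , _ ⟧ = filter G

      extensions : Poset (suc (c ⊔ ℓ)) (c ⊔ ℓ) (c ⊔ ℓ)
      extensions = record
        { Carrier = Extension
        ; _≈_ = λ G H → ⟦ G ⟧ ≐ ⟦ H ⟧
        ; _≤_ = λ G H → ⟦ G ⟧ ⊆ ⟦ H ⟧
        ; isPartialOrder = record
          { isPreorder = record
            { isEquivalence = record
              { refl  = id , id
              ; sym   = λ (p , q) → q , p
              ; trans = λ (p , q) (r , s) → (λ x → r (p x)) , (λ x → q (s x))
              }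
            ; reflexive = proj₁
            ; trans = λ p q x → q (p x)
            }
          ; antisym = λ p q → p , q
          }
        }

      ⋃ : Pred Extension (suc (c ⊔ ℓ)) → Subset
      ⋃ K a = Resize (∃[ G ] G ∈ K × a ∈ ⟦ G ⟧)

      module _ {K : Pred Extension (suc (c ⊔ ℓ))} (chain : IsChain extensions K) where

        ⋃-isFilter : ∃ K → IsFilter A (⋃ K)
        ⋃-isFilter (G , G∈K) = record
          { ⊤-mem    = resize (G , G∈K , IsFilter.⊤-mem (isFilter (proj₁ G)))
          ; ∧-closed = λ p q → resize (∧-case (unresize p) (unresize q))
          ; ≤-closed = λ a≤b p → let H , H∈K , a∈H = unresize p in
              resize (H , H∈K , IsFilter.≤-closed (isFilter (proj₁ H)) a≤b a∈H)
          }
          where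
          ∧-case : ∀ {a b} → ∃[ G ] G ∈ K × a ∈ ⟦ G ⟧ → ∃[ G ] G ∈ K × b ∈ ⟦ G ⟧ →
                   ∃[ G ] G ∈ K × a ∧ b ∈ ⟦ G ⟧
          ∧-case (G , G∈K , a∈G) (H , H∈K , b∈H) with chain G∈K H∈K
          ... | inj₁ G⊆H = H , H∈K , IsFilter.∧-closed (isFilter (proj₁ H)) (G⊆H a∈G) b∈H
          ... | inj₂ H⊆G = G , G∈K , IsFilter.∧-closed (isFilter (proj₁ G)) a∈G (H⊆G b∈H)

        upperBound : ∃ (IsUpperBound extensions K)
        upperBound with em {∃ K}
        -- The union of the empty chain is empty and hence no filter, so `F` itself is the bound.
        ... | no K-empty = (F , id) , λ G∈K → contradiction (_ , G∈K) K-empty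
        ... | yes (G , G∈K) = (union , λ a∈F → resize (G , G∈K , proj₂ G a∈F)) ,
                              λ {H} H∈K a∈H → resize (H , H∈K , a∈H)
          where
          union : FilterWithin
          union = record
            { filter   = ⋃ K
            ; isFilter = ⋃-isFilter (G , G∈K)
            ; within   = λ p → let H , _ , a∈H = unresize p in within (proj₁ H) a∈H
            }

      maximalExtension : ∃[ M ] filter F ⊆ filter M × IsMaximalWithin M
      maximalExtension with zorn extensions (λ K → upperBound {K})
      ... | (M , F⊆M) , M-max = M , F⊆M , λ G G-filter G⊆S M⊆G →
        proj₂ (M-max {record { filter = G ; isFilter = G-filter ; within = G⊆S }
                      , λ a∈F → M⊆G (F⊆M a∈F)} M⊆G)

  open FilterWithin

  -- A filter is proper exactly when its members are all nonzero, so maximal within `NonZero` means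
  -- maximal among proper filters.
  ultrafilterExtension : ∀ {F} → IsProperFilter A F → ∃[ u ] F ⊆ set u
  ultrafilterExtension {F} F-proper with maximalExtension NonZero record
    { filter   = F
    ; isFilter = IsProperFilter.isFilter F-proper
    ; within   = λ a∈F → lift λ a≤⊥ → IsProperFilter.proper F-proper
        (IsFilter.≤-closed (IsProperFilter.isFilter F-proper) a≤⊥ a∈F)
    }
    where
    NonZero : Subset
    NonZero a = Lift c (Not (a ≤ ⊥))
  ... | M , F⊆M , M-max = record
    { set = filter M
    ; isUltrafilter = record
      { isProperFilter = record
        { isFilter = isFilter M
        ; proper   = λ ⊥∈M → lower (within M ⊥∈M) ≤-refl
        }
      ; maximal = λ G G-proper → M-max G (IsProperFilter.isFilter G-proper)
          λ a∈G → lift λ a≤⊥ → IsProperFilter.proper G-proper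
            (IsFilter.≤-closed (IsProperFilter.isFilter G-proper) a≤⊥ a∈G)
      }
    } , F⊆M

  -- Otherwise an ultrafilter extending `F` and containing `¬ a` would be a point of `φ[ F ]`
  -- outside `φ a`.
  φ[]⊆φ⇒∈ : ∀ {F a} → IsFilter A F → φ[_] A F ⊆ φ A a → a ∈ F
  φ[]⊆φ⇒∈ {F} {a} F-filter φF⊆φa with em-small (a ∈ F)
  ... | yes a∈F = a∈F
  ... | no  a∉F =
    let v , F⊕¬a⊆v = ultrafilterExtension (⊕-↑¬-proper F-filter a∉F) in
    contradiction
      (φF⊆φa {v} (λ f∈F → F⊕¬a⊆v (⊆-⊕ˡ F-filter (↑-isFilter (¬ a)) f∈F)))
      (UltrafilterProperties.¬-∉ v (F⊕¬a⊆v (¬a∈⊕-↑¬ F-filter)))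

  φ[]-reflects-⊆ : ∀ {F G} → IsFilter A G → φ[_] A G ⊆ φ[_] A F → F ⊆ G
  φ[]-reflects-⊆ G-filter φG⊆φF f∈F =
    φ[]⊆φ⇒∈ G-filter λ {u} G⊆u → φG⊆φF {u} G⊆u f∈F

  -- The inclusion `D x F ⊆ y` constrains each member of `F` separately, so it says that `F` lies
  -- within the set `Admissible`, and the Zorn argument applies.
  minimalBelow : ∀ {F} x y → IsFilter A F → D A x F ⊆ set y →
    ∃[ M ] IsFilter A M × F ⊆ M × D A x M ⊆ set y × IsMinimalIn A (𝐂 A x y) (φ[_] A M)
  minimalBelow {F} x y F-filter DF⊆y with maximalExtension Admissible record
    { filter = F ; isFilter = F-filter ; within = λ a∈F b p → DF⊆y (_ , a∈F , p) }
    where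
    Admissible : Subset
    Admissible a = ∀ b → (a ⇒ b) ∈ set x → b ∈ set y
  ... | M , F⊆M , M-max = filter M , isFilter M , F⊆M , DM⊆y ,
    (((filter M , isFilter M , id , id) , (filter M , isFilter M , (id , id) , DM⊆y)) , minimal)
    where
    DM⊆y : D A x (filter M) ⊆ set y
    DM⊆y (a , a∈M , p) = within M a∈M _ p

    minimal : ∀ Z → Z ∈ 𝐂 A x y → Z ⊆ φ[_] A (filter M) → Z ≐ φ[_] A (filter M)
    minimal Z (_ , (G , G-filter , (Z⊆φG , φG⊆Z) , DG⊆y)) Z⊆φM =
      (λ {u} → Z⊆φM {u}) , λ {u} M⊆u → φG⊆Z {u} λ a∈G → M⊆u (G⊆M a∈G)
      where
      -- Since `Z` lies inside `φ[ M ]`, reflection of inclusions gives `M ⊆ G`; maximality of `M`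
      -- then gives the converse.
      G⊆M : G ⊆ filter M
      G⊆M = M-max G G-filter (λ a∈G b p → DG⊆y (_ , a∈G , p))
        (φ[]-reflects-⊆ G-filter λ {u} G⊆u → Z⊆φM {u} (φG⊆Z {u} G⊆u))

  -- The relation `θ Y` and the Boolean operations.

  module _ {Y : Pred (Ul A) (c ⊔ ℓ)} where

    θ-transport : ∀ {a b} → θ A Y a b → ∀ {u} → u ∈ Y → a ∈ set u → b ∈ set u
    θ-transport (p , _) {u} u∈Y a∈u = proj₂ (p {u} (u∈Y , a∈u))

    θ-sym : ∀ {a b} → θ A Y a b → θ A Y b a
    θ-sym (p , q) = q , p

    θ-intro : ∀ {a b} → (∀ u → u ∈ Y → a ∈ set u → b ∈ set u) →
              (∀ u → u ∈ Y → b ∈ set u → a ∈ set u) → θ A Y a b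
    θ-intro p q = (λ {u} (u∈Y , a∈u) → u∈Y , p u u∈Y a∈u) ,
                  (λ {u} (u∈Y , b∈u) → u∈Y , q u u∈Y b∈u)

    -- Symmetry of `θ` lets one implication serve for both inclusions.
    θ-congruent₂ : (_∙_ : Op₂ Carrier) →
      (∀ {a a′ b b′} → θ A Y a a′ → θ A Y b b′ →
        ∀ u → u ∈ Y → (a ∙ b) ∈ set u → (a′ ∙ b′) ∈ set u) →
      Congruent₂ (θ A Y) _∙_
    θ-congruent₂ _∙_ h p q = θ-intro (h p q) (h (θ-sym p) (θ-sym q))

    θ-∧ : Congruent₂ (θ A Y) _∧_
    θ-∧ = θ-congruent₂ _∧_ λ p q u u∈Y r →
      let open UltrafilterProperties u using (∧-closed; ∧-projˡ; ∧-projʳ) in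
      ∧-closed (θ-transport p u∈Y (∧-projˡ r)) (θ-transport q u∈Y (∧-projʳ r))

    θ-¬ : Congruent₁ (θ A Y) ¬_
    θ-¬ p = θ-intro (half p) (half (θ-sym p))
      where
      half : ∀ {a b} → θ A Y a b → ∀ u → u ∈ Y → ¬ a ∈ set u → ¬ b ∈ set u
      half p u u∈Y ¬a∈u = ∉-¬ λ b∈u → ¬-∉ ¬a∈u (θ-transport (θ-sym p) u∈Y b∈u)
        where open UltrafilterProperties u using (¬-∉; ∉-¬)

    θ-≈ : ∀ {a b} → a ≈ b → θ A Y a b
    θ-≈ a≈b = θ-intro (half a≈b) (half (sym a≈b))
      where
      half : ∀ {a b} → a ≈ b → ∀ u → u ∈ Y → a ∈ set u → b ∈ set u
      half a≈b u _ = UltrafilterProperties.≤-closed u (≤-reflexive a≈b)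

    θ-trans : ∀ {a b d} → θ A Y a b → θ A Y b d → θ A Y a d
    θ-trans p q = θ-intro
      (λ u u∈Y → θ-transport q u∈Y ∘ θ-transport p u∈Y)
      (λ u u∈Y → θ-transport (θ-sym p) u∈Y ∘ θ-transport (θ-sym q) u∈Y)

    -- De Morgan's law reduces joins to meets and complements, so primeness of ultrafilters is not
    -- called upon.
    θ-∨ : Congruent₂ (θ A Y) _∨_
    θ-∨ {a} {a′} {b} {b′} p q =
      θ-trans (θ-≈ (∨-as-∧ a b)) (θ-trans (θ-¬ (θ-∧ (θ-¬ p) (θ-¬ q))) (θ-≈ (sym (∨-as-∧ a′ b′))))
      where
      open BooleanAlgebraProperties booleanAlgebra using (deMorgan₂; ¬-involutive)
      ∨-as-∧ : ∀ x y → x ∨ y ≈ ¬ (¬ x ∧ ¬ y)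
      ∨-as-∧ x y = trans (sym (¬-involutive (x ∨ y))) (¬-cong (deMorgan₂ x y))

    -- From T-closed sets to congruences.

    tclosed⇒θ-⇒ : IsTClosed A Y → Congruent₂ (θ A Y) _⇒_
    tclosed⇒θ-⇒ Y-tclosed = θ-congruent₂ _⇒_ half
      where
      half : ∀ {a a′ b b′} → θ A Y a a′ → θ A Y b b′ →
             ∀ x → x ∈ Y → (a ⇒ b) ∈ set x → (a′ ⇒ b′) ∈ set x
      half {a} {a′} {b} {b′} p q x x∈Y a⇒b∈x = φ[]⊆φ⇒∈ (conditional-isFilter a′) λ {y} → b′-in {y}
        where
        open UltrafilterProperties x using (conditional-isFilter; ≤-closed)

        b′-in : φ[_] A (λ d → (a′ ⇒ d) ∈ set x) ⊆ φ A b′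
        b′-in {y} E⊆y =
          -- `D x (↑ a′)` lies inside `y`, since for `a′ ≤ d` membership of `d ⇒ e` in `x` entails
          -- that of `a′ ⇒ e`.
          let M , M-filter , ↑a′⊆M , DM⊆y , φM-min = minimalBelow x y (↑-isFilter a′)
                λ { (d , lift a′≤d , r) → E⊆y (≤-closed (⇒-antitoneˡ _ a′≤d) r) }
              φM⊆Y , y∈Y = IsTClosed.closure Y-tclosed x y (φ[_] A M) x∈Y φM-min
              -- Every ultrafilter containing `M` is in `Y` and contains `a′`, hence contains `a`.
              a∈M = φ[]⊆φ⇒∈ M-filter λ {z} M⊆z →
                θ-transport (θ-sym p) (φM⊆Y {z} M⊆z) (M⊆z (↑a′⊆M (lift ≤-refl)))
          in θ-transport q y∈Y (DM⊆y (a , a∈M , a⇒b∈x))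

    tclosed⇒congruence : IsTClosed A Y → IsCongruence A (θ A Y)
    tclosed⇒congruence Y-tclosed = record
      { isEquivalence = record { refl = θ-≈ refl ; sym = θ-sym ; trans = θ-trans }
      ; ≈-included    = θ-≈
      ; ∧-compatible  = θ-∧
      ; ∨-compatible  = θ-∨
      ; ¬-compatible  = θ-¬
      ; ⇒-compatible  = tclosed⇒θ-⇒ Y-tclosed
      }

    -- From congruences to T-closed sets.

    congruence⇒tclosed : IsClosed A Y → IsCongruence A (θ A Y) → IsTClosed A Y
    congruence⇒tclosed Y-closed@(G , G-filter , Y⊆φG , φG⊆Y) θ-congruence = record
      { isClosed = Y-closed ; closure = closure }
      where
      open IsCongruence θ-congruence using (⇒-compatible)

      -- Every point of `Y` contains `g`, so meeting with `g` changes nothing on `Y`.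
      θ-∧-absorb : ∀ {f g} → g ∈ G → θ A Y (f ∧ g) f
      θ-∧-absorb g∈G = θ-intro
        (λ u _ → UltrafilterProperties.∧-projˡ u)
        (λ u u∈Y f∈u → UltrafilterProperties.∧-closed u f∈u (Y⊆φG {u} u∈Y g∈G))

      closure : ∀ x y Z → x ∈ Y → IsMinimalIn A (𝐂 A x y) Z → Z ⊆ Y × y ∈ Y
      closure x y Z x∈Y ((_ , (F , F-filter , (Z⊆φF , φF⊆Z) , DF⊆y)) , Z-min) =
        Z⊆Y , φG⊆Y {y} G⊆y
        where
        open UltrafilterProperties x using (≤-closed; conditional-isFilter)

        F⊕G-filter : IsFilter A (F ⊕ G)
        F⊕G-filter = ⊕-isFilter F-filter G-filter

        DF⊕G⊆y : D A x (F ⊕ G) ⊆ set y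
        -- Antitonicity passes to the antecedent `f ∧ g`, which the congruence replaces by `f` at
        -- the point `x` of `Y`.
        DF⊕G⊆y (d , (f , g , f∈F , g∈G , f∧g≤d) , r) = DF⊆y (f , f∈F ,
          θ-transport (⇒-compatible (θ-∧-absorb g∈G) (θ-≈ refl)) x∈Y
            (≤-closed (⇒-antitoneˡ _ f∧g≤d) r))

        Z⊆Y : Z ⊆ Y
        Z⊆Y {u} u∈Z = φG⊆Y {u} λ g∈G → F⊕G⊆u (⊆-⊕ʳ F-filter G-filter g∈G)
          where
          F⊕G⊆u : F ⊕ G ⊆ set u
          -- `φ[ F ⊕ G ]` belongs to `𝐂 x y` and lies inside `Z`, so by minimality it equals `Z`.
          F⊕G⊆u = proj₂ (Z-min (φ[_] A (F ⊕ G))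
            ((F ⊕ G , F⊕G-filter , id , id) , (F ⊕ G , F⊕G-filter , (id , id) , DF⊕G⊆y))
            λ {v} F⊕G⊆v → φF⊆Z {v} λ f∈F → F⊕G⊆v (⊆-⊕ˡ F-filter G-filter f∈F)) {u} u∈Z

        G⊆y : G ⊆ set y
        -- On `Y` the elements `⊤` and `g` agree, so `⊤ ⇒ ⊤` in `x` yields `⊤ ⇒ g` in `x`; with `⊤`
        -- in `F` this puts `g` into `D x F`.
        G⊆y {g} g∈G = DF⊆y (⊤ , IsFilter.⊤-mem F-filter ,
          θ-transport (⇒-compatible (θ-≈ refl) θ-⊤-g) x∈Y
            (IsFilter.⊤-mem (conditional-isFilter ⊤)))
          where
          θ-⊤-g : θ A Y ⊤ g
          θ-⊤-g = θ-intro (λ u u∈Y _ → Y⊆φG {u} u∈Y g∈G)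
            (λ u _ _ → UltrafilterProperties.⊤-mem u)

theorem8p3 : ∀ {c ℓ} →
    ExcludedMiddle (suc (c ⊔ ℓ)) →
    ZornsLemma (suc (c ⊔ ℓ)) (c ⊔ ℓ) (c ⊔ ℓ) (suc (c ⊔ ℓ)) →
    (A : ConditionalAlgebra c ℓ) (Y : Pred (Ul A) (c ⊔ ℓ)) →
    IsClosed A Y →
    IsCongruence A (θ A Y) ⇔ IsTClosed A Y
theorem8p3 em zorn A Y Y-closed = mk⇔ (congruence⇒tclosed Y-closed) tclosed⇒congruence
  where open Classical em zorn A
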